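{- Let $F$ be the class of all two-sorted term-modal frames (for the fixed agent set $\mathcal{A}$). For every formula $\varphi$ of the language $\mathcal{L}$: if $\vdash_{\mathbf{K}_{TM}}\varphi$, then $\models_F\varphi$, i.e. $\varphi$ is valid on every frame in $F$.
   Context: Fix a finite nonempty set of agents $\mathcal{A}=\{\alpha_1,\dots,\alpha_n\}$ and two sorts $agt$, $obj$. The language $\mathcal{L}$ has: countably infinite sets $VAR_{agt}$, $VAR_{obj}$ of variables; a countable (possibly empty) set of constants, each with a sort; a countable (possibly empty) set of function symbols, each with an arity $\alpha\in\{agt,obj\}^{k+1}$, $k\ge 0$ (first $k$ entries: argument sorts; last entry: value sort); a countable (possibly empty) set of relation symbols, each with an arity $\beta\in\{agt,obj\}^k$, $k\ge 1$; the symbol $=$; $\neg,\to$; $\forall$; and a modal operator $K_t$ for every agent-sorted term $t$. Terms: variables, constants, and $f(t_1,\dots,t_k)$ with $t_i$ of sort $\alpha_i$ (of sort $\alpha_{k+1}$). Formulas: $t_1=t_2$ (any terms), $P(t_1,\dots,t_k)$ ($t_i$ of sort $\beta_i$), $\neg\varphi$, $\varphi\to\psi$, $\forall x\varphi$, $K_t\varphi$ ($t$ agent-sorted). Other connectives as usual, $\exists x:=\neg\forall x\neg$, $P_t:=\neg K_t\neg$. Free variables as usual, except that the free variables of $K_t\varphi$ are those of $t$ together with those of $\varphi$. $\varphi(t/x)$ denotes substitution of $t$ for the free occurrences of $x$ (renaming bound variables so no variable of $t$ becomes bound). A frame is $\langle W,\mathcal{R},DOM\rangle$ with $W\neq\emptyset$,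 $\mathcal{R}:\mathcal{A}\to\mathcal{P}(W\times W)$, and $DOM=DOM_{agt}\sqcup DOM_{obj}$ a disjoint union of nonempty sets with $DOM_{agt}=\mathcal{A}$. An interpretation $\mathcal{I}$ assigns to each relation symbol $P$ of arity $\beta$ and world $w$ a set $\mathcal{I}(P,w)\subseteq\prod_{i=1}^k DOM_{\beta_i}$; to each function symbol $f$ of arity $\alpha$ and $w$ a set $\mathcal{I}(f,w)\subseteq\prod_{i=1}^{k+1}DOM_{\alpha_i}$; $\mathcal{I}(=,w)=\{(d,d):d\in DOM\}$; to each constant $c$ of sort $\sigma$ and $w$ an element $\mathcal{I}(c,w)\in DOM_\sigma$. A model is a frame plus an interpretation (it is "based on" the frame). A valuation $v$ maps each $VAR_\sigma$ surjectively onto $DOM_\sigma$; an $x$-variant of $v$ agrees with $v$ except possibly at $x$. Extensions: $t^{w,v}=v(t)$ for a variable, $\mathcal{I}(t,w)$ for a constant. Truth: $\mathcal M,w\models_v P(t_1,\dots,t_k)$ iff $(t_1^{w,v},\dots,t_k^{w,v})\in\mathcal{I}(P,w)$; $\mathcal M,w\models_v t_1=t_2$ iff $t_1^{w,v}=t_2^{w,v}$; $\neg,\to$ classically; $\mathcal M,w\models_v\forall x\varphi$ iff $\mathcal M,w\models_{v'}\varphi$ for every $x$-variant $v'$ of $v$; $\mathcal M,w\models_v K_t\varphi$ iff $\mathcal M,w'\models_v\varphi$ for all $w'$ with $(w,w')\in\mathcal{R}(t^{w,v})$. A formula is valid in a frame if it is true at every world under every valuation in every model based on the frame; valid on a class of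 frames if valid in each of its frames. The system $\mathbf{K}_{TM}$: axioms are all substitution instances (by formulas of $\mathcal L$) of valid formulas of propositional modal logic, together with: ($\forall$) $\forall x\varphi\to\varphi(y/x)$ for any formula $\varphi$ and variable $y$ free in $\varphi$; (Id) $t=t$ for every term $t$; (MSD) $x\neq y$ for $x\in VAR_{agt}$, $y\in VAR_{obj}$; (PS) $(x=y)\to(\varphi(x)\to\varphi(y))$ for variables $x,y$ and formulas $\varphi$ (with $x,y$ agent-sorted when they occur as modal indices); ($\exists$Id) $(c=c)\to\exists x(x=c)$ for every constant $c$; (N) $\exists x_1\cdots\exists x_n\big(x_1\neq x_2\wedge\dots\wedge x_{n-1}\neq x_n\wedge\forall y(y=x_1\vee\dots\vee y=x_n)\big)$ for agent variables $x_1,\dots,x_n,y$, $n=|\mathcal A|$; (K) $K_t(\varphi\to\psi)\to(K_t\varphi\to K_t\psi)$; (BF) $\forall xK_t\varphi\to K_t\forall x\varphi$ for agent-sorted $t$ and variable $x\neq t$; (KNI) $(x\neq y)\to K_t(x\neq y)$ for variables $x,y$ and agent-sorted $t$. Rules: modus ponens; (KG) from $\varphi$ infer $K_t\varphi$ for agent-sorted $t$; (Gen) from $\varphi\to\psi$ infer $\varphi\to\forall x\psi$ when $x$ is not free in $\varphi$. $\vdash_{\mathbf{K}_{TM}}\varphi$ means $\varphi$ is the last line of a finite sequence each of whose members is an axiom or follows from earlier ones by a rule.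
   Formalization: In (BF), "x≠t" is read as "x does not occur in t", since the axiom is unsound for t=f(x); each I(f,w) is required to be the graph of a total function, so that f(t_1,…,t_k) has an extension; in (∀) and (∃Id) the two symbols share a sort. -}

module Defs where

open import Level using (0ℓ)
open import Data.Bool.Base using (if_then_else_)
open import Data.Empty using (⊥)
open import Data.Fin.Base using (Fin)
open import Data.List.Base using (List; []; _∷_; _++_; foldr)
open import Data.List.Membership.Propositional using (_∈_)
open import Data.List.NonEmpty.Base using (List⁺; toList)
open import Data.List.Relation.Unary.All using (All; []; _∷_)
open import Data.Nat.Base using (ℕ; suc)
import Data.Nat.Properties as ℕₚ
open import Data.Product.Base using (∃; _×_; _,_; proj₁)
open import Data.Product.Properties using (≡-dec)
open import Data.Product using (∃!)
open import Data.Sum.Base using (_⊎_)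
open import Data.Vec.Base as Vec using (Vec; []; _∷_)
open import Data.Vec.Relation.Unary.Unique.Propositional using (Unique)
open import Function.Bundles using (_↣_)
open import Function.Base using (id)
open import Function.Definitions using (StrictlySurjective)
open import Relation.Binary.Core using () renaming (Rel to BinRel)
open import Relation.Binary.Definitions using (DecidableEquality)
open import Relation.Binary.PropositionalEquality using (_≡_; _≢_; refl; cong)
open import Relation.Nullary using (¬_; yes; no)
open import Relation.Nullary.Decidable using (does; map′)
open import Relation.Unary using (Pred; U)

data Sort : Set where
  agt obj : Sort

_≟ˢ_ : DecidableEquality Sort
agt ≟ˢ agt = yes refl
agt ≟ˢ obj = no λ ()
obj ≟ˢ agt = no λ ()
obj ≟ˢ obj = yes refl

record Var (s : Sort) : Set where
  constructor mkVar
  field index : ℕ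

_≟ⱽ_ : ∀ {s} → DecidableEquality (Var s)
mkVar i ≟ⱽ mkVar j = map′ (cong mkVar) (cong Var.index) (i ℕₚ.≟ j)

SVar : Set
SVar = ∃ Var

_≟ˢⱽ_ : DecidableEquality SVar
_≟ˢⱽ_ = ≡-dec _≟ˢ_ _≟ⱽ_

_[_↦_] : (SVar → SVar) → SVar → SVar → (SVar → SVar)
(σ [ x ↦ y ]) z = if does (z ≟ˢⱽ x) then y else σ z

-- Symbols are grouped by arity.  Function symbols may be nullary; relation
-- symbols may not.  An injection into ℕ expresses "countable, possibly empty".
record Language : Set₁ where
  field
    Con : Sort → Set
    Fun : List Sort → Sort → Set
    Rel : List⁺ Sort → Set
    con-countable : ∃ Con ↣ ℕ
    fun-countable : (∃ λ αs → ∃ (Fun αs)) ↣ ℕ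
    rel-countable : ∃ Rel ↣ ℕ

-- Propositional modal logic with a family of modal operators □ i.
module PML where

  infixr 5 _⇒_

  data PForm (I : Set) : Set where
    atom : ℕ → PForm I
    ~_   : PForm I → PForm I
    _⇒_  : PForm I → PForm I → PForm I
    □    : I → PForm I → PForm I

  record KripkeModel (I : Set) : Set₁ where
    field
      W : Set
      R : I → BinRel W 0ℓ
      V : ℕ → Pred W 0ℓ

  infix 3 _,_⊩_

  _,_⊩_ : ∀ {I} (M : KripkeModel I) → KripkeModel.W M → PForm I → Set
  M , w ⊩ atom p = KripkeModel.V M p w
  M , w ⊩ ~ χ    = ¬ (M , w ⊩ χ)
  M , w ⊩ χ ⇒ ξ  = M , w ⊩ χ → M , w ⊩ ξ
  M , w ⊩ □ i χ  = ∀ w′ → KripkeModel.R M i w w′ → M , w′ ⊩ χ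

  PValid : ∀ {I} → PForm I → Set₁
  PValid {I} χ = (M : KripkeModel I) (w : KripkeModel.W M) → M , w ⊩ χ

-- The agent set is Fin (suc m), an arbitrary finite nonempty set.
module TermModal (L : Language) (m : ℕ) where

  open Language L

  Agent : Set
  Agent = Fin (suc m)

  ----------------------------------------------------------------------
  -- Syntax

  data Term : Sort → Set where
    var : ∀ {s} → Var s → Term s
    con : ∀ {s} → Con s → Term s
    fun : ∀ {αs s} → Fun αs s → All Term αs → Term s

  infix  7 _≐_ _≠_
  infix  6 ~_
  infixr 5 _∧_ _∨_
  infixr 4 _⇒_

  data Form : Set where
    _≐_ : ∀ {s s′} → Term s → Term s′ → Form
    rel : ∀ {βs} → Rel βs → All Term (toList βs) → Form
    ~_  : Form → Form
    _⇒_ : Form → Form → Form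
    all : ∀ {s} → Var s → Form → Form
    K   : Term agt → Form → Form

  _≠_ : ∀ {s s′} → Term s → Term s′ → Form
  t ≠ u = ~ (t ≐ u)

  _∧_ _∨_ : Form → Form → Form
  φ ∧ ψ = ~ (φ ⇒ ~ ψ)
  φ ∨ ψ = ~ φ ⇒ ψ

  ex : ∀ {s} → Var s → Form → Form
  ex x φ = ~ all x (~ φ)

  mutual
    _OccursIn_ : ∀ {s} → SVar → Term s → Set
    z OccursIn var x    = z ≡ (_ , x)
    z OccursIn con c    = ⊥
    z OccursIn fun f ts = z OccursInArgs ts

    _OccursInArgs_ : ∀ {αs} → SVar → All Term αs → Set
    z OccursInArgs []       = ⊥
    z OccursInArgs (t ∷ ts) = z OccursIn t ⊎ z OccursInArgs ts

  _FreeIn_ : SVar → Form → Set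
  z FreeIn (t ≐ u)  = z OccursIn t ⊎ z OccursIn u
  z FreeIn rel P ts = z OccursInArgs ts
  z FreeIn (~ φ)    = z FreeIn φ
  z FreeIn (φ ⇒ ψ)  = z FreeIn φ ⊎ z FreeIn ψ
  z FreeIn all x φ  = z ≢ (_ , x) × z FreeIn φ
  z FreeIn K t φ    = z OccursIn t ⊎ z FreeIn φ

  -- Subst σ φ ψ: ψ results from replacing every free variable z of φ by σ z,
  -- with bound variables renamed so that no σ z is captured.  It is a relation
  -- because the choice of new bound variables is left open, and because σ may
  -- change sorts: the result is then a formula only if the affected
  -- variables stand directly beside the equality symbol.
  mutual
    data SubstTerm (σ : SVar → SVar) : ∀ {s s′} → Term s → Term s′ → Set where
      var : ∀ {s s′} {x : Var s} {y : Var s′} →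
            σ (s , x) ≡ (s′ , y) → SubstTerm σ (var x) (var y)
      con : ∀ {s} {c : Con s} → SubstTerm σ (con c) (con c)
      fun : ∀ {αs s} {f : Fun αs s} {ts us : All Term αs} →
            SubstArgs σ ts us → SubstTerm σ (fun f ts) (fun f us)

    data SubstArgs (σ : SVar → SVar) : ∀ {αs} → All Term αs → All Term αs → Set where
      []  : SubstArgs σ [] []
      _∷_ : ∀ {s αs} {t u : Term s} {ts us : All Term αs} →
            SubstTerm σ t u → SubstArgs σ ts us → SubstArgs σ (t ∷ ts) (u ∷ us)

  data Subst (σ : SVar → SVar) : Form → Form → Set where
    eq  : ∀ {s₁ s₂ s₁′ s₂′} {t : Term s₁} {u : Term s₂} {t′ : Term s₁′} {u′ : Term s₂′} →
          SubstTerm σ t t′ → SubstTerm σ u u′ → Subst σ (t ≐ u) (t′ ≐ u′)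
    rel : ∀ {βs} {P : Rel βs} {ts us : All Term (toList βs)} →
          SubstArgs σ ts us → Subst σ (rel P ts) (rel P us)
    neg : ∀ {φ φ′} → Subst σ φ φ′ → Subst σ (~ φ) (~ φ′)
    imp : ∀ {φ ψ φ′ ψ′} → Subst σ φ φ′ → Subst σ ψ ψ′ → Subst σ (φ ⇒ ψ) (φ′ ⇒ ψ′)
    all : ∀ {s} {x x′ : Var s} {φ φ′} →
          (∀ z → z FreeIn all x φ → σ z ≢ (s , x′)) →
          Subst (σ [ (s , x) ↦ (s , x′) ]) φ φ′ → Subst σ (all x φ) (all x′ φ′)
    K   : ∀ {t t′ φ φ′} → SubstTerm σ t t′ → Subst σ φ φ′ → Subst σ (K t φ) (K t′ φ′)

  -- φ [ y / x ]≔ ψ: the formula ψ is φ(y/x).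
  _[_/_]≔_ : ∀ {s s′} → Form → Var s′ → Var s → Form → Set
  φ [ y / x ]≔ ψ = Subst (id [ (_ , x) ↦ (_ , y) ]) φ ψ

  ----------------------------------------------------------------------
  -- Semantics

  record Frame : Set₁ where
    field
      W      : Set
      w₀     : W
      R      : Agent → BinRel W 0ℓ
      DomObj : Set
      d₀     : DomObj

    Dom : Sort → Set
    Dom agt = Agent
    Dom obj = DomObj

    DOM : Set
    DOM = ∃ Dom

  -- Each I(f,w) is a set of tuples; it is required to be the graph of a
  -- function so that f(t₁,…,t_k) has an extension.
  record Interpretation (F : Frame) : Set₁ where
    open Frame F
    field
      I-con : ∀ {s} → Con s → W → Dom s
      I-rel : ∀ {βs} → Rel βs → W → Pred (All Dom (toList βs)) 0ℓ
      I-fun : ∀ {αs s} → Fun αs s → W → Pred (All Dom αs × Dom s) 0ℓ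
      I-fun-functional : ∀ {αs s} (f : Fun αs s) (w : W) (ds : All Dom αs) →
                         ∃! _≡_ λ d → I-fun f w (ds , d)

  module _ (F : Frame) where
    open Frame F

    Assignment : Set
    Assignment = ∀ s → Var s → Dom s

    IsValuation : Assignment → Set
    IsValuation v = ∀ s → StrictlySurjective _≡_ (v s)

    -- Surjectivity is not demanded of variants: otherwise ∀ x would fail to
    -- range over the whole domain whenever x alone takes its value.
    Variant : ∀ {s} → Var s → Assignment → Assignment → Set
    Variant {s} x v v′ =
      ∀ s′ (z : Var s′) → _≢_ {A = SVar} (s′ , z) (s , x) → v′ s′ z ≡ v s′ z

  module _ {F : Frame} (M : Interpretation F) where
    open Frame F
    open Interpretation M

    mutual
      ext : ∀ {s} → Term s → W → Assignment F → Dom s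
      ext (var x)    w v = v _ x
      ext (con c)    w v = I-con c w
      ext (fun f ts) w v = proj₁ (I-fun-functional f w (extArgs ts w v))

      extArgs : ∀ {αs} → All Term αs → W → Assignment F → All Dom αs
      extArgs []       w v = []
      extArgs (t ∷ ts) w v = ext t w v ∷ extArgs ts w v

    Truth : W → Assignment F → Form → Set
    Truth w v (_≐_ {s} {s′} t u) =
      _≡_ {A = DOM} (s , ext t w v) (s′ , ext u w v)
    Truth w v (rel P ts) = I-rel P w (extArgs ts w v)
    Truth w v (~ φ)      = ¬ Truth w v φ
    Truth w v (φ ⇒ ψ)    = Truth w v φ → Truth w v ψ
    Truth w v (all x φ)  = (v′ : Assignment F) → Variant F x v v′ → Truth w v′ φ
    Truth w v (K t φ)    = ∀ w′ → R (ext t w v) w w′ → Truth w′ v φ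

  ValidIn : Frame → Form → Set₁
  ValidIn F φ = (M : Interpretation F) (w : Frame.W F) (v : Assignment F) →
                IsValuation F v → Truth M w v φ

  ValidOn : Pred Frame 0ℓ → Form → Set₁
  ValidOn C φ = (F : Frame) → C F → ValidIn F φ

  AllFrames : Pred Frame 0ℓ
  AllFrames = U

  ----------------------------------------------------------------------
  -- The system K_TM

  -- Substitution instances: the propositional modal operators are the K_t
  -- themselves, and formulas are substituted for the atoms.
  instantiate : (ℕ → Form) → PML.PForm (Term agt) → Form
  instantiate θ (PML.atom p) = θ p
  instantiate θ (PML.~ χ)    = ~ instantiate θ χ
  instantiate θ (χ PML.⇒ ξ)  = instantiate θ χ ⇒ instantiate θ ξ
  instantiate θ (PML.□ t χ)  = K t (instantiate θ χ)

  distinctPairs : ∀ {k} → Vec (Var agt) k → List Form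
  distinctPairs []       = []
  distinctPairs (x ∷ xs) =
    Vec.toList (Vec.map (λ y → var x ≠ var y) xs) ++ distinctPairs xs

  -- The conjunction ranges over all pairs i < j and is empty for one agent.
  exactly : Vec (Var agt) (suc m) → Var agt → Form
  exactly xs y =
    Vec.foldr (λ _ → Form) ex
      (foldr _∧_
        (all y (Vec.foldr₁ _∨_ (Vec.map (λ x → var y ≐ var x) xs)))
        (distinctPairs xs))
      xs

  -- In ∀-inst and ∃Id the two symbols must share a sort; PS allows any sorts for
  -- which φ(y/x) is a formula.  In BF, x may not occur anywhere in t: for
  -- t = f(x) the formula ∀x K_t φ → K_t ∀x φ is not valid.
  data Axiom : Form → Set₁ where
    PMLinst : (χ : PML.PForm (Term agt)) (θ : ℕ → Form) →
              PML.PValid χ → Axiom (instantiate θ χ)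
    ∀-inst  : ∀ {s} (x y : Var s) (φ ψ : Form) →
              φ [ y / x ]≔ ψ → Axiom (all x φ ⇒ ψ)
    Id      : ∀ {s} (t : Term s) → Axiom (t ≐ t)
    MSD     : (x : Var agt) (y : Var obj) → Axiom (var x ≠ var y)
    PS      : ∀ {s s′} (x : Var s) (y : Var s′) (φ ψ : Form) →
              φ [ y / x ]≔ ψ → Axiom (var x ≐ var y ⇒ (φ ⇒ ψ))
    ∃Id     : ∀ {s} (c : Con s) (x : Var s) →
              Axiom (con c ≐ con c ⇒ ex x (var x ≐ con c))
    N       : (xs : Vec (Var agt) (suc m)) (y : Var agt) →
              Unique (y ∷ xs) → Axiom (exactly xs y)
    K-dist  : (t : Term agt) (φ ψ : Form) →
              Axiom (K t (φ ⇒ ψ) ⇒ (K t φ ⇒ K t ψ))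
    BF      : ∀ {s} (t : Term agt) (x : Var s) (φ : Form) →
              ¬ ((s , x) OccursIn t) → Axiom (all x (K t φ) ⇒ K t (all x φ))
    KNI     : ∀ {s s′} (x : Var s) (y : Var s′) (t : Term agt) →
              Axiom (var x ≠ var y ⇒ K t (var x ≠ var y))

  data Follows (Γ : List Form) : Form → Set₁ where
    axiom : ∀ {φ} → Axiom φ → Follows Γ φ
    MP    : ∀ {φ ψ} → (φ ⇒ ψ) ∈ Γ → φ ∈ Γ → Follows Γ ψ
    KG    : ∀ {φ} (t : Term agt) → φ ∈ Γ → Follows Γ (K t φ)
    Gen   : ∀ {s φ ψ} (x : Var s) → ¬ ((s , x) FreeIn φ) →
            (φ ⇒ ψ) ∈ Γ → Follows Γ (φ ⇒ all x ψ)

  -- Proofs are listed with the last line first.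
  data Proof : List Form → Set₁ where
    []  : Proof []
    _∷_ : ∀ {φ Γ} → Follows Γ φ → Proof Γ → Proof (φ ∷ Γ)

  infix 3 ⊢_

  ⊢_ : Form → Set₁
  ⊢ φ = ∃ λ Γ → Proof (φ ∷ Γ)

{-# OPTIONS --safe #-}
-- Validity is proved for arbitrary assignments, not only for surjective
-- valuations: an x-variant of a valuation need not be surjective, so only the
-- stronger claim is preserved by Gen.  For a fixed model and assignment v, a
-- propositional instance is read in the Kripke model whose accessibility for the
-- index t at w is that of the agent denoted by t at w; ∀-inst, PS, BF and Gen
-- rest on the substitution lemma, which works across worlds because variables are
-- rigid.
module Submission where

open import Defs
open import Level using (0ℓ)
open import Data.Nat.Base using (ℕ; suc)
open import Axiom.ExcludedMiddle using (ExcludedMiddle)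

open import Data.Fin.Base using (Fin; zero; suc)
open import Data.List.Base using ([]; _∷_; foldr)
open import Data.List.Relation.Unary.All using (All; []; _∷_; head; lookup)
open import Data.List.Relation.Unary.All.Properties using (++⁺)
open import Data.Product.Base using (∃; _,_; proj₁)
open import Data.Sum.Base using (inj₁; inj₂)
open import Data.Vec.Base as Vec using (Vec; []; _∷_)
open import Data.Vec.Membership.Propositional.Properties using (∈-lookup)
open import Data.Vec.Properties using (tabulate∘lookup)
import Data.Vec.Relation.Unary.All as VecAll
import Data.Vec.Relation.Unary.All.Properties as VecAllₚ
open import Data.Vec.Relation.Unary.AllPairs using (AllPairs; []; _∷_)
open import Data.Vec.Relation.Unary.AllPairs.Properties using (tabulate⁺)
open import Data.Vec.Relation.Unary.Any as Any using (Any; here; there)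
import Data.Vec.Relation.Unary.Any.Properties as Anyₚ
open import Data.Vec.Relation.Unary.Unique.Propositional using (Unique)
open import Function.Base using (id; _∘_)
open import Function.Bundles using (_⇔_; mk⇔; module Equivalence)
open import Relation.Binary.PropositionalEquality
  using (_≡_; _≢_; refl; sym; trans; cong; cong₂; subst)
open import Relation.Nullary using (¬_; yes; no; contradiction)

open Equivalence using (to; from)

,-injectiveʳ : ∀ {a b} {A : Set a} (B : A → Set b) {x : A} {y z : B x} →
               _≡_ {A = ∃ B} (x , y) (x , z) → y ≡ z
,-injectiveʳ _ refl = refl

module _ (L : Language) (m : ℕ) where

  open TermModal L m

  -- Substitutions that fix the free variables.

  mutual
    SubstTerm-refl : ∀ {σ s} (t : Term s) →
                     (∀ z → z OccursIn t → σ z ≡ z) → SubstTerm σ t t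
    SubstTerm-refl (var x)    fix = var (fix _ refl)
    SubstTerm-refl (con c)    fix = con
    SubstTerm-refl (fun f ts) fix = fun (SubstArgs-refl ts fix)

    SubstArgs-refl : ∀ {σ αs} (ts : All Term αs) →
                     (∀ z → z OccursInArgs ts → σ z ≡ z) → SubstArgs σ ts ts
    SubstArgs-refl []       fix = []
    SubstArgs-refl (t ∷ ts) fix =
      SubstTerm-refl t (λ z → fix z ∘ inj₁) ∷ SubstArgs-refl ts (λ z → fix z ∘ inj₂)

  -- Lets the coincidence lemma be read off from the substitution lemma. Bound variables are kept: a
  -- free variable of `all x φ` is sent to itself, hence never to `x`, so nothing is captured.
  Subst-refl : ∀ {σ} φ → (∀ z → z FreeIn φ → σ z ≡ z) → Subst σ φ φ
  Subst-refl (t ≐ u) fix =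
    eq (SubstTerm-refl t (λ z → fix z ∘ inj₁)) (SubstTerm-refl u (λ z → fix z ∘ inj₂))
  Subst-refl (rel P ts) fix = rel (SubstArgs-refl ts fix)
  Subst-refl (~ φ)      fix = neg (Subst-refl φ fix)
  Subst-refl (φ ⇒ ψ)    fix =
    imp (Subst-refl φ (λ z → fix z ∘ inj₁)) (Subst-refl ψ (λ z → fix z ∘ inj₂))
  Subst-refl {σ} (all {s} x φ) fix =
    all (λ z free σz≡x → proj₁ free (trans (sym (fix z free)) σz≡x)) (Subst-refl φ fix′)
    where
    fix′ : ∀ z → z FreeIn φ → (σ [ (s , x) ↦ (s , x) ]) z ≡ z
    fix′ z free with z ≟ˢⱽ (s , x)
    ... | yes refl = refl
    ... | no  z≢x  = fix z (z≢x , free)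
  Subst-refl (K t φ) fix =
    K (SubstTerm-refl t (λ z → fix z ∘ inj₁)) (Subst-refl φ (λ z → fix z ∘ inj₂))

  -- Assignments, updates and agreement along a substitution.

  module _ {F : Frame} where

    open Frame F

    -- The sort is kept beside the element because a substitution may change sorts, so values before
    -- and after it can be compared only in `DOM`.
    value : Assignment F → SVar → DOM
    value v (s , x) = s , v s x

    _[_≔_] : ∀ {s} → Assignment F → Var s → Dom s → Assignment F
    _[_≔_] {s} v x d s′ z with (s′ , z) ≟ˢⱽ (s , x)
    ... | yes refl = d
    ... | no  _    = v s′ z

    ≔-same : ∀ {s} v (x : Var s) d → (v [ x ≔ d ]) s x ≡ d
    ≔-same {s} v x d with (s , x) ≟ˢⱽ (s , x)
    ... | yes refl = refl
    ... | no  x≢x  = contradiction refl x≢x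

    ≔-variant : ∀ {s} v (x : Var s) d → Variant F x v (v [ x ≔ d ])
    ≔-variant {s} v x d s′ z z≢x with (s′ , z) ≟ˢⱽ (s , x)
    ... | yes z≡x = contradiction z≡x z≢x
    ... | no  _   = refl

    variant-value : ∀ {s} {x : Var s} {v v′} → Variant F x v v′ →
                    ∀ {z} → z ≢ (s , x) → value v′ z ≡ value v z
    variant-value vr z≢x = cong (_ ,_) (vr _ _ z≢x)

    -- The head is updated first, in the order in which a block of quantifiers over `xs` is opened
    -- from the outside.
    _[_≔*_] : ∀ {k} → Assignment F → Vec (Var agt) k → (Fin k → Agent) → Assignment F
    v [ []     ≔* f ] = v
    v [ x ∷ xs ≔* f ] = (v [ x ≔ f zero ]) [ xs ≔* f ∘ suc ]

    ≔*-other : ∀ {k} v {x} (xs : Vec (Var agt) k) f → VecAll.All (x ≢_) xs →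
               (v [ xs ≔* f ]) agt x ≡ v agt x
    ≔*-other v []       f VecAll.[]           = refl
    ≔*-other v (y ∷ xs) f (x≢y VecAll.∷ x∉xs) =
      trans (≔*-other _ xs (f ∘ suc) x∉xs)
            (≔-variant v y (f zero) agt _ (x≢y ∘ ,-injectiveʳ Var))

    ≔*-lookup : ∀ {k} v (xs : Vec (Var agt) k) f → Unique xs →
                ∀ i → (v [ xs ≔* f ]) agt (Vec.lookup xs i) ≡ f i
    ≔*-lookup v (x ∷ xs) f (x∉xs ∷ _) zero =
      trans (≔*-other _ xs (f ∘ suc) x∉xs) (≔-same v x (f zero))
    ≔*-lookup v (x ∷ xs) f (_ ∷ uniq) (suc i) = ≔*-lookup _ xs (f ∘ suc) uniq i

    Agree : (SVar → SVar) → Assignment F → Assignment F → (SVar → Set) → Set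
    Agree σ u v Z = ∀ z → Z z → value u z ≡ value v (σ z)

    -- Serves both ∀-inst, where `u` is an update of `v` at `x`, and PS, where `u` is `v` itself.
    agree-↦ : ∀ {s} {x : Var s} {y : SVar} {Z u v} → value u (s , x) ≡ value v y →
              Variant F x v u → Agree (id [ (s , x) ↦ y ]) u v Z
    agree-↦ {s} {x} x≡y vr z _ with z ≟ˢⱽ (s , x)
    ... | yes refl = x≡y
    ... | no  z≢x  = variant-value vr z≢x

    -- The substitution lemma.

    module _ (M : Interpretation F) where

      open Interpretation M

      mutual
        ext-subst : ∀ {σ s s′} {t : Term s} {t′ : Term s′} u v w → SubstTerm σ t t′ →
                    Agree σ u v (_OccursIn t) →
                    _≡_ {A = DOM} (s , ext M t w u) (s′ , ext M t′ w v)
        ext-subst u v w (var σx≡y) agree = trans (agree _ refl) (cong (value v) σx≡y)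
        ext-subst u v w con agree = refl
        ext-subst u v w (fun {f = f} ts) agree =
          cong (λ ds → _ , proj₁ (I-fun-functional f w ds)) (extArgs-subst u v w ts agree)

        extArgs-subst : ∀ {σ αs} {ts us : All Term αs} u v w → SubstArgs σ ts us →
                        Agree σ u v (_OccursInArgs ts) →
                        extArgs M ts w u ≡ extArgs M us w v
        extArgs-subst u v w []       agree = refl
        extArgs-subst u v w (t ∷ ts) agree =
          cong₂ _∷_ (,-injectiveʳ Dom (ext-subst u v w t (λ z → agree z ∘ inj₁)))
                    (extArgs-subst u v w ts (λ z → agree z ∘ inj₂))

      -- Carries agreement under a binder. At `x` both sides take the common new value; at any other
      -- free `z`, freshness keeps `σ z` apart from `x′`, so both sides keep their old values.
      agree-variant : ∀ {σ s} {x x′ : Var s} {φ u v u′ v′} →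
                      Agree σ u v (_FreeIn all x φ) →
                      (∀ z → z FreeIn all x φ → σ z ≢ (s , x′)) →
                      Variant F x u u′ → Variant F x′ v v′ → u′ s x ≡ v′ s x′ →
                      Agree (σ [ (s , x) ↦ (s , x′) ]) u′ v′ (_FreeIn φ)
      agree-variant {σ} {s} {x} agree fresh vr-u vr-v u′x≡v′x′ z free with z ≟ˢⱽ (s , x)
      ... | yes refl = cong (s ,_) u′x≡v′x′
      ... | no  z≢x  =
        trans (variant-value vr-u z≢x)
          (trans (agree z (z≢x , free)) (sym (variant-value vr-v (fresh z (z≢x , free)))))

      -- Induction on the substitution; an equivalence is needed because negation and implication
      -- reverse direction. `Agree` mentions no world, so it passes unchanged to the successors in
      -- the `K` case.
      Truth-subst : ∀ {σ φ ψ} u v w → Subst σ φ ψ → Agree σ u v (_FreeIn φ) →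
                    Truth M w u φ ⇔ Truth M w v ψ
      Truth-subst u v w (eq S T) agree = mk⇔
        (λ e → trans (sym t≡) (trans e u≡))
        (λ e → trans t≡ (trans e (sym u≡)))
        where
        t≡ = ext-subst u v w S (λ z → agree z ∘ inj₁)
        u≡ = ext-subst u v w T (λ z → agree z ∘ inj₂)
      Truth-subst u v w (rel {P = P} ts) agree =
        mk⇔ (subst (I-rel P w) ts≡) (subst (I-rel P w) (sym ts≡))
        where ts≡ = extArgs-subst u v w ts agree
      Truth-subst u v w (neg S) agree = mk⇔ (_∘ from ih) (_∘ to ih)
        where ih = Truth-subst u v w S agree
      Truth-subst u v w (imp S T) agree = mk⇔
        (λ h → to ihT ∘ h ∘ from ihS)
        (λ h → from ihT ∘ h ∘ to ihS)
        where
        ihS = Truth-subst u v w S (λ z → agree z ∘ inj₁)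
        ihT = Truth-subst u v w T (λ z → agree z ∘ inj₂)
      Truth-subst u v w (all {s} {x} {x′} {φ} fresh S) agree = mk⇔
        -- A variant of `v` at `x′` is matched by the update of `u` at `x` with the same element;
        -- the converse direction is symmetric.
        (λ h v′ vr-v → to
          (Truth-subst _ v′ w S (agree-variant {φ = φ} agree fresh
            (≔-variant u x (v′ s x′)) vr-v (≔-same u x (v′ s x′))))
          (h _ (≔-variant u x (v′ s x′))))
        (λ h u′ vr-u → from
          (Truth-subst u′ _ w S (agree-variant {φ = φ} agree fresh
            vr-u (≔-variant v x′ (u′ s x)) (sym (≔-same v x′ (u′ s x)))))
          (h _ (≔-variant v x′ (u′ s x))))
      Truth-subst u v w (K {t} {t′} T S) agree = mk⇔
        (λ h w′ r → to   (ih w′) (h w′ (subst (λ a → R a w w′) (sym t≡) r)))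
        (λ h w′ r → from (ih w′) (h w′ (subst (λ a → R a w w′) t≡ r)))
        where
        t≡ : ext M t w u ≡ ext M t′ w v
        t≡ = ,-injectiveʳ Dom (ext-subst u v w T (λ z → agree z ∘ inj₁))
        ih = λ w′ → Truth-subst u v w′ S (λ z → agree z ∘ inj₂)

      -- Coincidence: changing a variable that does not occur free.

      ext-variant : ∀ {s s′} {x : Var s} (t : Term s′) {v v′} w → ¬ ((s , x) OccursIn t) →
                    Variant F x v v′ → ext M t w v′ ≡ ext M t w v
      ext-variant t {v} {v′} w x∉t vr =
        ,-injectiveʳ Dom (ext-subst v′ v w (SubstTerm-refl {id} t (λ _ _ → refl))
          (λ { z occ → variant-value vr λ { refl → x∉t occ } }))

      -- The substitution lemma for `id`: `v` and `v′` differ at most at `x`, so they agree on the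
      -- free variables of `φ`.
      Truth-variant : ∀ {s} {x : Var s} φ {v v′} w → ¬ ((s , x) FreeIn φ) →
                      Variant F x v v′ → Truth M w v φ → Truth M w v′ φ
      Truth-variant φ {v} {v′} w x∉φ vr =
        from (Truth-subst v′ v w (Subst-refl {id} φ (λ _ _ → refl))
          (λ { z free → variant-value vr λ { refl → x∉φ free } }))

      -- Propositional instances.

      kripke : Assignment F → (ℕ → Form) → PML.KripkeModel (Term agt)
      kripke v θ = record
        { W = W
        ; R = λ t w w′ → R (ext M t w v) w w′
        ; V = λ p w → Truth M w v (θ p)
        }

      Truth-instantiate : ∀ v θ χ w →
        (PML._,_⊩_ (kripke v θ) w χ) ⇔ Truth M w v (instantiate θ χ)
      Truth-instantiate v θ (PML.atom p) w = mk⇔ id id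
      Truth-instantiate v θ (PML.~ χ)    w = mk⇔ (_∘ from ih) (_∘ to ih)
        where ih = Truth-instantiate v θ χ w
      Truth-instantiate v θ (χ PML.⇒ ξ)  w = mk⇔
        (λ h → to ihξ ∘ h ∘ from ihχ)
        (λ h → from ihξ ∘ h ∘ to ihχ)
        where
        ihχ = Truth-instantiate v θ χ w
        ihξ = Truth-instantiate v θ ξ w
      Truth-instantiate v θ (PML.□ t χ)  w = mk⇔
        (λ h w′ r → to   (Truth-instantiate v θ χ w′) (h w′ r))
        (λ h w′ r → from (Truth-instantiate v θ χ w′) (h w′ r))

      -- The axiom N on the number of agents.

      Truth-foldr-ex : ∀ {k w} v (xs : Vec (Var agt) k) f φ →
                       Truth M w (v [ xs ≔* f ]) φ →
                       Truth M w v (Vec.foldr (λ _ → Form) ex φ xs)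
      Truth-foldr-ex v []       f φ h   = h
      Truth-foldr-ex v (x ∷ xs) f φ h n =
        -- `ex` unfolds to a negated universal, so the claimed universal `n` is refuted at the
        -- witness `f zero`.
        n _ (≔-variant v x (f zero)) (Truth-foldr-ex _ xs (f ∘ suc) φ h)

      Truth-foldr-∧ : ∀ {w v φ φs} → Truth M w v φ → All (Truth M w v) φs →
                      Truth M w v (foldr _∧_ φ φs)
      Truth-foldr-∧ h []       = h
      Truth-foldr-∧ h (p ∷ ps) n = n p (Truth-foldr-∧ h ps)

      Truth-foldr₁-∨ : ∀ {k w v} {φs : Vec Form (suc k)} → Any (Truth M w v) φs →
                       Truth M w v (Vec.foldr₁ _∨_ φs)
      Truth-foldr₁-∨ {φs = φ ∷ []}    (here p)   = p
      Truth-foldr₁-∨ {φs = φ ∷ _ ∷ _} (here p) n = contradiction p n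
      Truth-foldr₁-∨ {φs = φ ∷ _ ∷ _} (there p) _ = Truth-foldr₁-∨ p

      Truth-distinctPairs : ∀ {k w v} {xs : Vec (Var agt) k} →
                            AllPairs (λ x y → v agt x ≢ v agt y) xs →
                            All (Truth M w v) (distinctPairs xs)
      Truth-distinctPairs []           = []
      Truth-distinctPairs (x≢ ∷ pairs) =
        ++⁺ (VecAllₚ.toList⁺ (VecAllₚ.map⁺ (VecAll.map (_∘ ,-injectiveʳ Dom) x≢)))
            (Truth-distinctPairs pairs)

      -- There are as many variables in `xs` as agents, so the witness for the variable at position
      -- `i` is the agent `i` itself.
      Truth-exactly : ∀ w v (xs : Vec (Var agt) (suc m)) y → Unique (y ∷ xs) →
                      Truth M w v (exactly xs y)
      Truth-exactly w v xs y (y∉xs ∷ uniq) =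
        Truth-foldr-ex v xs id _ (Truth-foldr-∧ covered (Truth-distinctPairs distinct))
        where
        v* = v [ xs ≔* id ]

        v*-lookup : ∀ i → v* agt (Vec.lookup xs i) ≡ i
        v*-lookup = ≔*-lookup v xs id uniq

        distinct : AllPairs (λ x x′ → v* agt x ≢ v* agt x′) xs
        -- Writing `xs` as the table of its entries reduces the claim to distinct positions, whose
        -- values are those positions.
        distinct = subst (AllPairs _) (tabulate∘lookup xs)
          (tabulate⁺ λ i≢j e → i≢j (trans (sym (v*-lookup _)) (trans e (v*-lookup _))))

        covered : Truth M w v* (all y (Vec.foldr₁ _∨_ (Vec.map (λ x → var y ≐ var x) xs)))
        covered v′ vr = Truth-foldr₁-∨ (Anyₚ.map⁺ (Any.map
          (λ x≡ → cong (agt ,_) (trans (sym v′-lookup) (cong (v′ agt) x≡)))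
          (∈-lookup i xs)))
          where
          -- The agent denoted by `y` is also the position of the variable naming it; that variable
          -- differs from `y`, so it keeps its value in `v′`.
          i = v′ agt y

          v′-lookup : v′ agt (Vec.lookup xs i) ≡ i
          v′-lookup = trans
            (vr agt (Vec.lookup xs i) (VecAllₚ.lookup⁺ y∉xs i ∘ sym ∘ ,-injectiveʳ Var))
            (v*-lookup i)

      -- Soundness of the axioms and rules.

      Truth-axiom : ∀ {φ} → Axiom φ → ∀ w v → Truth M w v φ
      Truth-axiom (PMLinst χ θ valid) w v =
        to (Truth-instantiate v θ χ w) (valid (kripke v θ) w)
      Truth-axiom (∀-inst {s} x y φ ψ S) w v h =
        to (Truth-subst _ v w S (agree-↦ (cong (s ,_) (≔-same v x (v s y))) vr-x)) (h _ vr-x)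
        where vr-x = ≔-variant v x (v s y)
      Truth-axiom (Id t) w v = refl
      -- Equality in `DOM` would identify the sorts `agt` and `obj`.
      Truth-axiom (MSD x y) w v ()
      Truth-axiom (PS x y φ ψ S) w v x≡y =
        to (Truth-subst v v w S (agree-↦ x≡y (λ _ _ _ → refl)))
      Truth-axiom (∃Id {s} c x) w v _ n =
        n _ (≔-variant v x (I-con c w)) (cong (s ,_) (≔-same v x (I-con c w)))
      Truth-axiom (N xs y uniq) w v = Truth-exactly w v xs y uniq
      Truth-axiom (K-dist t φ ψ) w v h k w′ r = h w′ r (k w′ r)
      Truth-axiom (BF t x φ x∉t) w v h w′ r v′ vr =
        -- All worlds share one domain, so the variant `v′` chosen at `w′` can be used at `w`; there
        -- `t` denotes the same agent under `v` and `v′`, so `w′` remains accessible.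
        h v′ vr w′ (subst (λ a → R a w w′) (sym (ext-variant t w x∉t vr)) r)
      Truth-axiom (KNI x y t) w v x≢y w′ _ = x≢y

      True : Form → Set
      True φ = ∀ w v → Truth M w v φ

      Follows-sound : ∀ {Γ φ} → Follows Γ φ → All True Γ → True φ
      Follows-sound (axiom a)  ih w v = Truth-axiom a w v
      Follows-sound (MP i j)   ih w v = lookup ih i w v (lookup ih j w v)
      Follows-sound (KG t i)   ih w v w′ _ = lookup ih i w′ v
      Follows-sound (Gen {φ = φ} x x∉φ i) ih w v h v′ vr =
        -- The premise is used at `v′`, after its antecedent has been moved there from `v`.
        lookup ih i w v′ (Truth-variant φ w x∉φ vr h)

      Proof-sound : ∀ {Γ} → Proof Γ → All True Γ
      Proof-sound []      = []
      Proof-sound (f ∷ p) = Follows-sound f (Proof-sound p) ∷ Proof-sound p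

theorem6p2 : ExcludedMiddle 0ℓ →
    (L : Language) (m : ℕ) → let open TermModal L m in
    (φ : Form) → ⊢ φ → ValidOn AllFrames φ
theorem6p2 _ L m φ (Γ , proof) F _ M w v _ = head (Proof-sound L m M proof) w v
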